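{- Let $\mathbf{L}\in\{\mathbf{K}_D,\mathbf{KD}_D,\mathbf{KT}_D\}$ and let $\Gamma\Rightarrow\Delta$ be a sequent. If $\Gamma\Rightarrow\Delta$ is valid in every finite model of the class $\mathbb{M}_{\mathbf{L}}$ (where $\mathbb{M}_{\mathbf{K}_D}=\mathbb{M}$, $\mathbb{M}_{\mathbf{KD}_D}=\mathbb{M}_{\mathbf{ser}}$, $\mathbb{M}_{\mathbf{KT}_D}=\mathbb{M}_{\mathbf{ref}}$), then $\mathsf{G}(\mathbf{L})\vdash\Gamma\Rightarrow\Delta$.
   Context: Language: fix a finite nonempty set $\mathsf{Agt}$ of agents and a countable set $\mathsf{Prop}$ of propositional variables; $\mathsf{Grp}$ is the set of nonempty subsets of $\mathsf{Agt}$. Formulas: $\alpha::=p\mid\bot\mid\alpha\wedge\alpha\mid\alpha\vee\alpha\mid\alpha\rightarrow\alpha\mid\neg\alpha\mid D_G\alpha$ ($p\in\mathsf{Prop}$, $G\in\mathsf{Grp}$). Outmost-boxed formula: one of the form $D_G\gamma$. Semantics: a model $M=(W,(R_G)_{G\in\mathsf{Grp}},V)$ has a set $W$ of states, binary relations $R_G$ on $W$ with $R_H\subseteq R_G$ whenever $G\subseteq H$, and $V:\mathsf{Prop}\to\mathcal P(W)$; it is finite if $W$ is finite. Truth is classical for connectives and $M,w\models D_G\alpha$ iff $M,v\models\alpha$ for all $v$ with $(w,v)\in R_G$. $\mathbb{M}$: all models; $\mathbb{M}_{\mathbf{ser}}$: models with $R_{\{a\}}$ serial for every $a\in\mathsf{Agt}$;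 $\mathbb{M}_{\mathbf{ref}}$: models with every $R_G$ reflexive. A sequent $\Gamma\Rightarrow\Delta$ is valid in a class if $\bigwedge\Gamma\rightarrow\bigvee\Delta$ is true at every state of every model in it (empty conjunction $\top$, empty disjunction $\bot$). Sequent calculi (sequents $\Gamma\Rightarrow\Delta$ are pairs of finite multisets; derivable = root of a finite tree built from initial sequents by rules): $\mathsf{G}(\mathbf{K}_D)$ has initial sequents $\Gamma,p\Rightarrow p,\Delta$ and $\bot,\Gamma\Rightarrow\Delta$; rules $(R\wedge)$ from $\Gamma\Rightarrow\Delta,\alpha_1$ and $\Gamma\Rightarrow\Delta,\alpha_2$ infer $\Gamma\Rightarrow\Delta,\alpha_1\wedge\alpha_2$; $(L\wedge)$ from $\alpha_1,\alpha_2,\Gamma\Rightarrow\Delta$ infer $\alpha_1\wedge\alpha_2,\Gamma\Rightarrow\Delta$; $(R\vee)$ from $\Gamma\Rightarrow\Delta,\alpha_1,\alpha_2$ infer $\Gamma\Rightarrow\Delta,\alpha_1\vee\alpha_2$; $(L\vee)$ from $\alpha_1,\Gamma\Rightarrow\Delta$ and $\alpha_2,\Gamma\Rightarrow\Delta$ infer $\alpha_1\vee\alpha_2,\Gamma\Rightarrow\Delta$; $(R\rightarrow)$ from $\alpha_1,\Gamma\Rightarrow\Delta,\alpha_2$ infer $\Gamma\Rightarrow\Delta,\alpha_1\rightarrow\alpha_2$; $(L\rightarrow)$ from $\Gamma\Rightarrow\Delta,\alpha_1$ and $\alpha_2,\Gamma\Rightarrow\Delta$ infer $\alpha_1\rightarrow\alpha_2,\Gamma\Rightarrow\Delta$;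 $(R\neg)$ from $\alpha,\Gamma\Rightarrow\Delta$ infer $\Gamma\Rightarrow\Delta,\neg\alpha$; $(L\neg)$ from $\Gamma\Rightarrow\Delta,\alpha$ infer $\neg\alpha,\Gamma\Rightarrow\Delta$; $(D_K)$: from $\alpha_1,\dots,\alpha_n\Rightarrow\beta$ ($n\ge0$) infer $\Sigma,D_{G_1}\alpha_1,\dots,D_{G_n}\alpha_n\Rightarrow D_G\beta,\Omega$ where all $G_i\subseteq G$, $\Sigma$ consists only of propositional variables, $\bot$, and $D_H\gamma$ with $H\not\subseteq G$, and $\Omega$ only of propositional variables, $\bot$, outmost-boxed formulas. $\mathsf{G}(\mathbf{KD}_D)$ adds $(D_D)$: from $\Gamma\Rightarrow$ with $\Gamma\neq\emptyset$ infer $\Sigma,D_{\{a\}}\Gamma\Rightarrow\Omega$, $\Sigma$ only propositional variables, $\bot$, $D_H\gamma$ with $H\neq\{a\}$; $\Omega$ only propositional variables, $\bot$, outmost-boxed formulas. $\mathsf{G}(\mathbf{KT}_D)$ adds to $\mathsf{G}(\mathbf{K}_D)$ $(D_T)$: from $D_G\alpha,\alpha,\Gamma\Rightarrow\Delta$ infer $D_G\alpha,\Gamma\Rightarrow\Delta$. -}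

module Defs where

open import Data.Empty using (⊥)
open import Data.Fin using (Fin)
open import Data.Fin.Subset as Sub using (Subset; Nonempty)
open import Data.Fin.Subset.Properties using (x∈⁅x⁆)
open import Data.List using (List; []; _∷_; [_]; _++_; map; foldr)
open import Data.List.Relation.Binary.Permutation.Propositional using (_↭_)
open import Data.List.Relation.Unary.All using (All)
open import Data.Nat using (ℕ; suc)
open import Data.Product using (_×_; _,_; ∃; proj₁; proj₂)
open import Data.Sum using (_⊎_)
open import Data.Unit using (⊤)
open import Function.Bundles using (_↔_)
open import Level using (0ℓ)
open import Relation.Binary using (Rel; Reflexive; Decidable)
open import Relation.Binary.PropositionalEquality using (_≡_; _≢_)
open import Relation.Nullary using (¬_)
import Relation.Unary as U

data Logic : Set where
  K-D KD-D KT-D : Logic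

-- The agents are Fin (suc m): a finite, nonempty set.
module Epistemic (m : ℕ) (PropVar : Set) where

  Agt : Set
  Agt = Fin (suc m)

  -- The irrelevant field makes groups with the same members equal,
  -- whatever the proof of nonemptiness.
  record Grp : Set where
    constructor grp
    field
      members   : Subset (suc m)
      .nonempty : Nonempty members

  open Grp public

  infix 4 _⊆_ _⊈_

  _⊆_ : Grp → Grp → Set
  G ⊆ H = members G Sub.⊆ members H

  _⊈_ : Grp → Grp → Set
  G ⊈ H = ¬ (G ⊆ H)

  ⁅_⁆ : Agt → Grp
  ⁅ a ⁆ = grp Sub.⁅ a ⁆ (a , x∈⁅x⁆ a)

  infixr 7 _∧′_
  infixr 6 _∨′_
  infixr 5 _→′_
  infix  8 ¬′_

  data Formula : Set where
    var            : PropVar → Formula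
    ⊥′             : Formula
    _∧′_ _∨′_ _→′_ : Formula → Formula → Formula
    ¬′_            : Formula → Formula
    D              : Grp → Formula → Formula

  ⊤′ : Formula
  ⊤′ = ¬′ ⊥′

  ⋀ ⋁ : List Formula → Formula
  ⋀ = foldr _∧′_ ⊤′
  ⋁ = foldr _∨′_ ⊥′

  record Model : Set₁ where
    field
      W        : Set
      R        : Grp → Rel W 0ℓ
      antitone : ∀ {G H} → G ⊆ H → ∀ {w v} → R H w v → R G w v
      V        : PropVar → U.Pred W 0ℓ

  open Model public

  infix 4 _at_⊨_

  _at_⊨_ : (M : Model) → W M → Formula → Set
  M at w ⊨ var p  = V M p w
  M at w ⊨ ⊥′     = ⊥
  M at w ⊨ α ∧′ β = M at w ⊨ α × M at w ⊨ β
  M at w ⊨ α ∨′ β = M at w ⊨ α ⊎ M at w ⊨ β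
  M at w ⊨ α →′ β = M at w ⊨ α → M at w ⊨ β
  M at w ⊨ ¬′ α   = ¬ (M at w ⊨ α)
  M at w ⊨ D G α  = ∀ v → R M G w v → M at v ⊨ α

  -- Finiteness of W is read with decidable relations and valuation, which is
  -- automatic classically. In such models _at_⊨_ is decidable, so that it is
  -- the classical truth relation.
  record IsFinite (M : Model) : Set where
    field
      size : ℕ
      enum : W M ↔ Fin size
      R?   : ∀ G → Decidable (R M G)
      V?   : ∀ p → U.Decidable (V M p)

  Serial : {A : Set} → Rel A 0ℓ → Set
  Serial _∼_ = ∀ x → ∃ λ y → x ∼ y

  𝕄 : Logic → Model → Set
  𝕄 K-D  M = ⊤
  𝕄 KD-D M = ∀ a → Serial (R M ⁅ a ⁆)
  𝕄 KT-D M = ∀ G → Reflexive (R M G)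

  Valid : (Model → Set) → List Formula → List Formula → Set₁
  Valid C Γ Δ = ∀ M → C M → ∀ w → M at w ⊨ (⋀ Γ →′ ⋁ Δ)

  -- Formulas D H γ are only allowed for groups H satisfying P.
  data Side (P : Grp → Set) : Formula → Set where
    var : ∀ p → Side P (var p)
    bot : Side P ⊥′
    box : ∀ {H} γ → P H → Side P (D H γ)

  infix 3 _⊢_⇒_

  -- Multisets are lists up to permutation; the constructor perm expresses that
  -- derivability depends only on the multisets and is not a rule of the calculi.
  data _⊢_⇒_ (L : Logic) : List Formula → List Formula → Set where
    perm : ∀ {Γ Γ′ Δ Δ′} → Γ ↭ Γ′ → Δ ↭ Δ′ → L ⊢ Γ ⇒ Δ → L ⊢ Γ′ ⇒ Δ′

    init  : ∀ {Γ Δ} p → L ⊢ var p ∷ Γ ⇒ var p ∷ Δ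
    init⊥ : ∀ {Γ Δ} → L ⊢ ⊥′ ∷ Γ ⇒ Δ

    R∧ : ∀ {Γ Δ α β} → L ⊢ Γ ⇒ α ∷ Δ → L ⊢ Γ ⇒ β ∷ Δ → L ⊢ Γ ⇒ α ∧′ β ∷ Δ
    L∧ : ∀ {Γ Δ α β} → L ⊢ α ∷ β ∷ Γ ⇒ Δ → L ⊢ α ∧′ β ∷ Γ ⇒ Δ
    R∨ : ∀ {Γ Δ α β} → L ⊢ Γ ⇒ α ∷ β ∷ Δ → L ⊢ Γ ⇒ α ∨′ β ∷ Δ
    L∨ : ∀ {Γ Δ α β} → L ⊢ α ∷ Γ ⇒ Δ → L ⊢ β ∷ Γ ⇒ Δ → L ⊢ α ∨′ β ∷ Γ ⇒ Δ
    R→ : ∀ {Γ Δ α β} → L ⊢ α ∷ Γ ⇒ β ∷ Δ → L ⊢ Γ ⇒ (α →′ β) ∷ Δ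
    L→ : ∀ {Γ Δ α β} → L ⊢ Γ ⇒ α ∷ Δ → L ⊢ β ∷ Γ ⇒ Δ → L ⊢ (α →′ β) ∷ Γ ⇒ Δ
    R¬ : ∀ {Γ Δ α} → L ⊢ α ∷ Γ ⇒ Δ → L ⊢ Γ ⇒ ¬′ α ∷ Δ
    L¬ : ∀ {Γ Δ α} → L ⊢ Γ ⇒ α ∷ Δ → L ⊢ ¬′ α ∷ Γ ⇒ Δ

    -- The list Θ holds the pairs (Gᵢ , αᵢ).
    D-K : ∀ {Σ Ω G β} (Θ : List (Grp × Formula)) →
          All (λ Gα → proj₁ Gα ⊆ G) Θ →
          All (Side (_⊈ G)) Σ →
          All (Side (λ _ → ⊤)) Ω →
          L ⊢ map proj₂ Θ ⇒ [ β ] →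
          L ⊢ Σ ++ map (λ Gα → D (proj₁ Gα) (proj₂ Gα)) Θ ⇒ D G β ∷ Ω

    D-D : ∀ {Γ Σ Ω} a → L ≡ KD-D →
          Γ ≢ [] →
          All (Side (_≢ ⁅ a ⁆)) Σ →
          All (Side (λ _ → ⊤)) Ω →
          L ⊢ Γ ⇒ [] →
          L ⊢ Σ ++ map (D ⁅ a ⁆) Γ ⇒ Ω

    D-T : ∀ {Γ Δ G α} → L ≡ KT-D →
          L ⊢ D G α ∷ α ∷ Γ ⇒ Δ → L ⊢ D G α ∷ Γ ⇒ Δ

{-# OPTIONS --safe #-}
module Submission where

-- Root-first proof search decides every sequent: it ends either in a derivation
-- or in a finite tree refuting the sequent. The propositional rules (and D-T) are
-- invertible, so they reduce a sequent to saturated ones, and each formula can be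
-- processed by structural induction. A saturated sequent is refuted by a root
-- whose children refute the premises of all applicable instances of D-K and D-D;
-- these have smaller modal depth. Reflexivity (for KT) and seriality (for KD, at
-- nodes without a suitable child) are achieved by loops. A tree becomes a finite
-- model whose worlds are its subtrees.

open import Defs
open import Data.Bool using (true; false)
import Data.Bool.Properties as Bool
open import Data.Empty using (⊥; ⊥-elim; ⊥-elim-irr)
open import Data.Fin using (Fin)
import Data.Fin.Properties as Fin
import Data.Fin.Subset as Sub
open import Data.Fin.Subset.Properties using (x∈⁅y⁆⇒x≡y; _∈?_; _⊆?_; ⊆-antisym)
open import Data.List using (List; []; _∷_; [_]; _++_; map; filter; length; lookup; allFin)
open import Data.List.Membership.Propositional using (_∈_; _∉_; lose; find)
open import Data.List.Membership.Propositional.Properties using (∈-∃++; ∈-lookup; ∈-filter⁺; ∈-++⁺ˡ; ∈-++⁺ʳ; ∈-map⁺; ∈-allFin)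
import Data.List.Membership.DecPropositional as DecMembership
open import Data.List.Properties using (++-assoc; ++-identityʳ; map-++; ≡-dec)
open import Data.List.Relation.Binary.Permutation.Propositional using (_↭_; prep; ↭-refl; ↭-sym; ↭-trans; ↭-reflexive)
open import Data.List.Relation.Binary.Permutation.Propositional.Properties using (shift; map⁺; ++⁺ˡ; All-resp-↭)
open import Data.List.Relation.Unary.All as All using (All; []; _∷_)
import Data.List.Relation.Unary.All.Properties as All
open import Data.List.Relation.Unary.Any as Any using (Any; here; there; any?)
import Data.List.Relation.Unary.Any.Properties as Any
open import Data.Nat using (ℕ; zero; suc; _⊔_; _≤_; _<_; s≤s⁻¹)
import Data.Nat.Properties as ℕ
open import Data.Product using (_×_; _,_; ∃; proj₁; proj₂; map₂)
open import Data.Sum as Sum using (_⊎_; inj₁; inj₂)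
open import Data.Unit using (⊤; tt)
import Data.Vec.Properties as Vec
open import Function using (_∘_; id)
open import Function.Bundles using (_↣_)
open import Function.Construct.Identity using (↔-id)
open import Relation.Binary using (DecidableEquality)
open import Relation.Binary.PropositionalEquality using (_≡_; _≢_; refl; sym; cong; subst)
open import Relation.Nullary using (¬_; Dec; yes; no; does; contradiction)
open import Relation.Nullary.Decidable using (map′; via-injection; _×-dec_; _⊎-dec_; ¬?)
open import Relation.Unary.Properties using (∁?)
import Relation.Unary as U

-- Permutations of lists and searches through lists.

filter-∁-↭ : ∀ {A : Set} {P : A → Set} (P? : U.Decidable P) xs →
             filter (∁? P?) xs ++ filter P? xs ↭ xs
filter-∁-↭ P? [] = ↭-refl
filter-∁-↭ P? (x ∷ xs) with does (P? x)
... | true  = ↭-trans (shift x (filter (∁? P?) xs) _) (prep x (filter-∁-↭ P? xs))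
... | false = prep x (filter-∁-↭ P? xs)

∈⇒↭ : ∀ {A : Set} {x : A} {xs} → x ∈ xs → ∃ λ ys → x ∷ ys ↭ xs
∈⇒↭ x∈xs with ys , zs , refl ← ∈-∃++ x∈xs = ys ++ zs , ↭-sym (shift _ ys zs)

-- `A` will be a derivation of the whole sequent: one found at any element ends the search, and
-- otherwise every element has yielded its part of a refutation.
unless : ∀ {A X : Set} {Q : X → Set} xs → (∀ {x} → x ∈ xs → A ⊎ Q x) → A ⊎ All Q xs
unless []       f = inj₂ []
unless (x ∷ xs) f with f (here refl) | unless xs (f ∘ there)
... | inj₁ a | _       = inj₁ a
... | inj₂ _ | inj₁ a  = inj₁ a
... | inj₂ q | inj₂ qs = inj₂ (q ∷ qs)

collect : ∀ {X Y : Set} {Good : Y → Set} {S : X → Y → Set} {T : X → Set} {xs} →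
          All (λ x → (∃ λ y → Good y × S x y) ⊎ T x) xs →
          ∃ λ ys → All Good ys × All (λ x → Any (S x) ys ⊎ T x) xs
collect [] = [] , [] , []
collect (inj₂ t ∷ ps) with ys , good , qs ← collect ps = ys , good , inj₂ t ∷ qs
collect (inj₁ (y , g , s) ∷ ps) with ys , good , qs ← collect ps =
  y ∷ ys , g ∷ good , inj₁ (here s) ∷ All.map (Sum.map₁ there) qs

isKT? : ∀ L → Dec (L ≡ KT-D)
isKT? K-D  = no λ ()
isKT? KD-D = no λ ()
isKT? KT-D = yes refl

-- Groups of agents.

module Groups (m : ℕ) (PropVar : Set) where
  open Epistemic m PropVar

  members-injective : ∀ {G H} → members G ≡ members H → G ≡ H
  members-injective refl = refl

  _≟ᴳ_ : DecidableEquality Grp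
  G ≟ᴳ H = map′ members-injective (cong members) (Vec.≡-dec Bool._≟_ (members G) (members H))

  ⊆⁅⁆⇒≡ : ∀ {a} G → G ⊆ ⁅ a ⁆ → G ≡ ⁅ a ⁆
  ⊆⁅⁆⇒≡ {a} (grp S ne) S⊆a = members-injective (⊆-antisym S⊆a a⊆S)
    where
    a∈S : a Sub.∈ S
    a∈S with a ∈? S
    ... | yes a∈ = a∈
    -- Nonemptiness is irrelevant, so its witness may serve only to reach a contradiction; this is
    -- why membership of `a` is decided first.
    ... | no  a∉ = ⊥-elim-irr (a∉ (subst (Sub._∈ S) (x∈⁅y⁆⇒x≡y a (S⊆a (proj₂ ne))) (proj₂ ne)))

    a⊆S : Sub.⁅ a ⁆ Sub.⊆ S
    a⊆S x∈a = subst (Sub._∈ S) (sym (x∈⁅y⁆⇒x≡y a x∈a)) a∈S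

-- Restriction of a model to a finite list of worlds.

module Restriction (m : ℕ) (PropVar : Set) (M : Epistemic.Model m PropVar) (ws : List (Epistemic.Model.W M)) where
  open Epistemic m PropVar

  -- Worlds are positions in `ws`, so finiteness is immediate; a repeated entry merely gives copies
  -- of a world.
  restriction : Model
  restriction = record
    { W        = Fin (length ws)
    ; R        = λ G i j → R M G (lookup ws i) (lookup ws j)
    ; antitone = λ G⊆H → antitone M G⊆H
    ; V        = λ p i → V M p (lookup ws i)
    }

  module _ (closed : ∀ {G w v} → w ∈ ws → R M G w v → v ∈ ws) where

    -- Implication and negation swap the two directions. Closure matters for `D` in `restriction⁻`,
    -- where an arbitrary successor needs a position in `ws`.
    restriction⁺ : ∀ α i → M at lookup ws i ⊨ α → restriction at i ⊨ α
    restriction⁻ : ∀ α i → restriction at i ⊨ α → M at lookup ws i ⊨ α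

    restriction⁺ (var p)  i x = x
    restriction⁺ ⊥′       i ()
    restriction⁺ (α ∧′ β) i (x , y) = restriction⁺ α i x , restriction⁺ β i y
    restriction⁺ (α ∨′ β) i x = Sum.map (restriction⁺ α i) (restriction⁺ β i) x
    restriction⁺ (α →′ β) i f = restriction⁺ β i ∘ f ∘ restriction⁻ α i
    restriction⁺ (¬′ α)   i f = f ∘ restriction⁻ α i
    restriction⁺ (D G α)  i f j r = restriction⁺ α j (f (lookup ws j) r)

    restriction⁻ (var p)  i x = x
    restriction⁻ ⊥′       i ()
    restriction⁻ (α ∧′ β) i (x , y) = restriction⁻ α i x , restriction⁻ β i y
    restriction⁻ (α ∨′ β) i x = Sum.map (restriction⁻ α i) (restriction⁻ β i) x
    restriction⁻ (α →′ β) i f = restriction⁻ β i ∘ f ∘ restriction⁺ α i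
    restriction⁻ (¬′ α)   i f = f ∘ restriction⁺ α i
    restriction⁻ (D G α)  i f v r =
      subst (M at_⊨ α) (sym v≡) (restriction⁻ α j (f j (subst (R M G (lookup ws i)) v≡ r)))
      where
      v∈ws : v ∈ ws
      v∈ws = closed (∈-lookup i) r
      j : Fin (length ws)
      j = Any.index v∈ws
      v≡ : v ≡ lookup ws j
      v≡ = Any.lookup-index v∈ws

    restriction-𝕄 : ∀ L → 𝕄 L M → 𝕄 L restriction
    restriction-𝕄 K-D  _   = tt
    restriction-𝕄 KT-D ref G = ref G
    restriction-𝕄 KD-D ser a i with v , r ← ser a (lookup ws i) =
      Any.index v∈ws , subst (R M ⁅ a ⁆ (lookup ws i)) (Any.lookup-index v∈ws) r
      where
      v∈ws : v ∈ ws
      v∈ws = closed (∈-lookup i) r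

module Completeness (m : ℕ) (PropVar : Set) (_≟_ : DecidableEquality PropVar) (L : Logic) where
  open Epistemic m PropVar
  open Groups m PropVar

  -- Trees as the worlds of a single model.

  data Tree : Set where
    node : List PropVar → List (Grp × Tree) → Tree

  vars : Tree → List PropVar
  vars (node P _) = P

  kids : Tree → List (Grp × Tree)
  kids (node _ ks) = ks

  -- Edges compare worlds, and `IsFinite` asks for decidable relations.
  _≟ᵀ_  : DecidableEquality Tree
  _≟ᵀ*_ : DecidableEquality (List (Grp × Tree))
  node P ks ≟ᵀ node Q ls =
    map′ (λ { (refl , refl) → refl }) (λ { refl → refl , refl }) (≡-dec _≟_ P Q ×-dec ks ≟ᵀ* ls)
  []             ≟ᵀ* []             = yes refl
  []             ≟ᵀ* (_ ∷ _)        = no λ ()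
  (_ ∷ _)        ≟ᵀ* []             = no λ ()
  ((G , t) ∷ ks) ≟ᵀ* ((H , u) ∷ ls) =
    map′ (λ { (refl , refl , refl) → refl }) (λ { refl → refl , refl , refl })
      (G ≟ᴳ H ×-dec t ≟ᵀ u ×-dec ks ≟ᵀ* ls)

  -- For KD, a tree loops for agent `a` only if no child's label contains `a`. Writing `G ⊆ ⁅ a ⁆`,
  -- which for nonempty groups means equality, makes antitonicity immediate.
  Loop : Logic → Grp → Tree → Set
  Loop K-D  G t = ⊥
  Loop KD-D G t = ∃ λ a → G ⊆ ⁅ a ⁆ × ¬ Any (λ k → ⁅ a ⁆ ⊆ proj₁ k) (kids t)
  Loop KT-D G t = ⊤

  Loop? : ∀ L G t → Dec (Loop L G t)
  Loop? K-D  G t = no λ ()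
  Loop? KD-D G t = Fin.any? λ a → (members G ⊆? Sub.⁅ a ⁆) ×-dec
                     ¬? (any? (λ k → Sub.⁅ a ⁆ ⊆? members (proj₁ k)) (kids t))
  Loop? KT-D G t = yes tt

  Loop-antitone : ∀ L {G H t} → G ⊆ H → Loop L H t → Loop L G t
  Loop-antitone KD-D G⊆H (a , H⊆a , dead) = a , (λ x → H⊆a (G⊆H x)) , dead
  Loop-antitone KT-D _   _ = tt

  Edge : Grp → Tree → Tree → Set
  Edge G t u = Any (λ k → G ⊆ proj₁ k × proj₂ k ≡ u) (kids t) ⊎ (t ≡ u × Loop L G t)

  trees : Model
  trees = record
    { W        = Tree
    ; R        = Edge
    ; antitone = λ G⊆H → Sum.map (Any.map λ (H⊆k , eq) → (λ x → H⊆k (G⊆H x)) , eq)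
                                 (map₂ (Loop-antitone L G⊆H))
    ; V        = λ p t → p ∈ vars t
    }

  Edge? : ∀ G t u → Dec (Edge G t u)
  Edge? G t u = any? (λ k → (members G ⊆? members (proj₁ k)) ×-dec (proj₂ k ≟ᵀ u)) (kids t)
                ⊎-dec ((t ≟ᵀ u) ×-dec Loop? L G t)

  trees-𝕄 : ∀ L′ → L ≡ L′ → 𝕄 L′ trees
  trees-𝕄 K-D  _    = tt
  trees-𝕄 KT-D refl G = inj₂ (refl , tt)
  trees-𝕄 KD-D refl a t with any? (λ k → Sub.⁅ a ⁆ ⊆? members (proj₁ k)) (kids t)
  ... | yes k with (_ , u) , k∈ , a⊆ ← find k = u , inj₁ (lose k∈ (a⊆ , refl))
  ... | no dead = t , inj₂ (refl , a , id , dead)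

  -- Subtrees and finite countermodels.

  subtrees  : Tree → List Tree
  subtrees* : List (Grp × Tree) → List Tree
  subtrees (node P ks) = node P ks ∷ subtrees* ks
  subtrees* []             = []
  subtrees* ((_ , u) ∷ ks) = subtrees u ++ subtrees* ks

  root∈subtrees : ∀ t → t ∈ subtrees t
  root∈subtrees (node _ _) = here refl

  kids∈subtrees* : ∀ ks {k} → k ∈ ks → proj₂ k ∈ subtrees* ks
  kids∈subtrees* ((_ , u) ∷ ks) (here refl) = ∈-++⁺ˡ (root∈subtrees u)
  kids∈subtrees* ((_ , u) ∷ ks) (there k∈)  = ∈-++⁺ʳ (subtrees u) (kids∈subtrees* ks k∈)

  subtrees-kids  : ∀ s {t k} → t ∈ subtrees s → k ∈ kids t → proj₂ k ∈ subtrees s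
  subtrees*-kids : ∀ ks {t k} → t ∈ subtrees* ks → k ∈ kids t → proj₂ k ∈ subtrees* ks
  subtrees-kids (node P ks) (here refl) k∈ = there (kids∈subtrees* ks k∈)
  subtrees-kids (node P ks) (there t∈)  k∈ = there (subtrees*-kids ks t∈ k∈)
  subtrees*-kids ((_ , u) ∷ ks) t∈ k∈ with Any.++⁻ (subtrees u) t∈
  ... | inj₁ t∈u  = ∈-++⁺ˡ (subtrees-kids u t∈u k∈)
  ... | inj₂ t∈ks = ∈-++⁺ʳ (subtrees u) (subtrees*-kids ks t∈ks k∈)

  subtrees-closed : ∀ s {G t u} → t ∈ subtrees s → Edge G t u → u ∈ subtrees s
  subtrees-closed s t∈ (inj₁ e) with _ , k∈ , _ , refl ← find e = subtrees-kids s t∈ k∈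
  subtrees-closed s t∈ (inj₂ (refl , _)) = t∈

  infix 4 _⊩_ _⊮_

  _⊩_ _⊮_ : Tree → Formula → Set
  t ⊩ α = trees at t ⊨ α
  t ⊮ α = ¬ (t ⊩ α)

  ⊩-⋀ : ∀ {M : Model} {w} {Γ} → All (M at w ⊨_) Γ → M at w ⊨ ⋀ Γ
  ⊩-⋀ []       = λ ()
  ⊩-⋀ (x ∷ xs) = x , ⊩-⋀ xs

  ⊮-⋁ : ∀ {M : Model} {w} {Δ} → All (λ α → ¬ (M at w ⊨ α)) Δ → ¬ (M at w ⊨ ⋁ Δ)
  ⊮-⋁ (n ∷ ns) (inj₁ x) = n x
  ⊮-⋁ (n ∷ ns) (inj₂ x) = ⊮-⋁ ns x

  -- An edge from a subtree of `t` ends in a subtree of `t`, so restricting `trees` to these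
  -- preserves truth and yields a finite model of the right class.
  refutable⇒¬Valid : ∀ {Γ Δ} t → All (t ⊩_) Γ → All (t ⊮_) Δ →
                     ¬ Valid (λ M → IsFinite M × 𝕄 L M) Γ Δ
  refutable⇒¬Valid {Γ} {Δ} t ts fs valid =
    ⊮-⋁ (All.map (λ {α} f x → f (subst (_⊩ α) (sym t≡) (restriction⁻ closed α i x))) fs)
      (valid restriction (finite , restriction-𝕄 closed L (trees-𝕄 L refl)) i
        (⊩-⋀ (All.map (λ {α} x → restriction⁺ closed α i (subst (_⊩ α) t≡ x)) ts)))
    where
    open Restriction m PropVar trees (subtrees t)
    closed : ∀ {G u v} → u ∈ subtrees t → Edge G u v → v ∈ subtrees t
    closed = subtrees-closed t
    i : Fin (length (subtrees t))
    i = Any.index (root∈subtrees t)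
    t≡ : t ≡ lookup (subtrees t) i
    t≡ = Any.lookup-index (root∈subtrees t)
    finite : IsFinite restriction
    finite = record
      { size = length (subtrees t)
      ; enum = ↔-id _
      ; R?   = λ G j k → Edge? G (lookup (subtrees t) j) (lookup (subtrees t) k)
      ; V?   = λ p j → DecMembership._∈?_ _≟_ p (vars (lookup (subtrees t) j))
      }

  -- Modal depth and partially processed sequents.

  depth : Formula → ℕ
  depth (var p)  = 0
  depth ⊥′       = 0
  depth (α ∧′ β) = depth α ⊔ depth β
  depth (α ∨′ β) = depth α ⊔ depth β
  depth (α →′ β) = depth α ⊔ depth β
  depth (¬′ α)   = depth α
  depth (D G α)  = suc (depth α)

  depth-bound : ∀ Γ → ∃ λ d → All (λ α → depth α < d) Γ
  depth-bound []      = 0 , []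
  depth-bound (α ∷ Γ) with d , bs ← depth-bound Γ =
    suc (depth α) ⊔ d ,
    ℕ.m≤m⊔n _ d ∷ All.map (λ b → ℕ.≤-trans b (ℕ.m≤n⊔m (suc (depth α)) d)) bs

  Decided : List Formula → List Formula → Set
  Decided Γ Δ = L ⊢ Γ ⇒ Δ ⊎ ∃ λ t → All (t ⊩_) Γ × All (t ⊮_) Δ

  Literal : Formula → Set
  Literal = Side (λ _ → ⊤)

  □ : Grp × Formula → Formula
  □ (G , α) = D G α

  _⊆ᴳ?_ : ∀ (k : Grp × Formula) G → Dec (proj₁ k ⊆ G)
  k ⊆ᴳ? G = members (proj₁ k) ⊆? members G

  -- The fully processed part P, B ⇒ Ω of a sequent.
  record Done (d : ℕ) : Set where
    constructor done
    field
      {P}  : List PropVar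
      {B}  : List (Grp × Formula)
      {Ω}  : List Formula
      lits : All Literal Ω
      B<   : All (λ k → depth (proj₂ k) < d) B
      Ω≤   : All (λ ω → depth ω ≤ d) Ω

    ante : List Formula
    ante = map var P ++ map □ B

  open Done

  -- What a saturated root guarantees for D G α on the left. For KT the loop
  -- also requires α at t, which is only known once the instance of D-T that put
  -- α on the left has been unwound.
  Boxed : Tree → Grp × Formula → Set
  Boxed t (G , α) = All (λ k → G ⊆ proj₁ k → proj₂ k ⊩ α) (kids t) × (L ≢ KT-D → ¬ Loop L G t)

  Boxed⇒⊩ : ∀ {t G} α → Boxed t (G , α) → (L ≡ KT-D → t ⊩ α) → t ⊩ D G α
  Boxed⇒⊩ α (at-kids , _) at-root v (inj₁ e) with _ , k∈ , G⊆ , refl ← find e =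
    All.lookup at-kids k∈ G⊆
  Boxed⇒⊩ α (_ , no-loop) at-root v (inj₂ (refl , loop)) with isKT? L
  ... | yes eq = at-root eq
  ... | no neq = contradiction loop (no-loop neq)

  record Refutation {d} (Γ Δ : List Formula) (c : Done d) : Set where
    constructor refutation
    field
      tree : Tree
      Γ-⊩  : All (tree ⊩_) Γ
      P-⊩  : All (_∈ vars tree) (P c)
      B-⊩  : All (Boxed tree) (B c)
      Δ-⊮  : All (tree ⊮_) Δ
      Ω-⊮  : All (tree ⊮_) (Ω c)

  -- `Γ` and `Δ` are still to be processed. Quantifying over every processed part `c` makes the
  -- steps below transformers of solvers: a formula is taken apart and the solver for the rest is
  -- called with an enlarged `c`, so recursion is structural in the formula.
  Solvable : ℕ → List Formula → List Formula → Set
  Solvable d Γ Δ = (c : Done d) → L ⊢ Γ ++ ante c ⇒ Δ ++ Ω c ⊎ Refutation Γ Δ c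

  -- Backward application of the invertible rules.

  addΩ : ∀ {d Γ Δ ω} → Literal ω → depth ω ≤ d → Solvable d Γ Δ → Solvable d Γ (ω ∷ Δ)
  addΩ {Δ = Δ} {ω} lit ω≤ s c@(done ls bs ωs) with s (done {P = P c} (lit ∷ ls) bs (ω≤ ∷ ωs))
  ... | inj₁ der = inj₁ (perm ↭-refl (shift ω Δ _) der)
  ... | inj₂ (refutation t γ p b δ (w ∷ ws)) = inj₂ (refutation t γ p b (w ∷ δ) ws)

  -- `Boxed` is returned beside the refutation because passing from it to the truth of `D G α` may
  -- need `α` at the root, which only the caller can supply.
  addBox : ∀ {d Γ Δ G α} → depth α < d → (c : Done d) →
           Solvable d Γ Δ → L ⊢ Γ ++ D G α ∷ ante c ⇒ Δ ++ Ω c ⊎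
           ∃ λ (r : Refutation Γ Δ c) → Boxed (Refutation.tree r) (G , α)
  addBox {Γ = Γ} {G = G} {α} α< c@(done ls bs ωs) s with s (done {P = P c} {B = (G , α) ∷ B c} ls (α< ∷ bs) ωs)
  ... | inj₁ der = inj₁ (perm (++⁺ˡ Γ (shift (D G α) (map var (P c)) _)) ↭-refl der)
  ... | inj₂ (refutation t γ p (b ∷ bs′) δ w) = inj₂ (refutation t γ p bs′ δ w , b)

  -- Derivations of all premises of the rule for `α` combine to one of the conclusion, and by
  -- invertibility a tree refuting one premise refutes the conclusion.
  addL : ∀ {d Γ Δ} α → depth α ≤ d → Solvable d Γ Δ → Solvable d (α ∷ Γ) Δ
  addR : ∀ {d Γ Δ} α → depth α ≤ d → Solvable d Γ Δ → Solvable d Γ (α ∷ Δ)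

  addL {Γ = Γ} (var p) _ s c@(done ls bs ωs) with s (done {P = p ∷ P c} ls bs ωs)
  ... | inj₁ der = inj₁ (perm (shift (var p) Γ _) ↭-refl der)
  ... | inj₂ (refutation t γ (x ∷ p) b δ w) = inj₂ (refutation t (x ∷ γ) p b δ w)
  addL ⊥′ _ s c = inj₁ init⊥
  addL (α ∧′ β) αβ≤ s c
    with addL α (ℕ.m⊔n≤o⇒m≤o _ _ αβ≤) (addL β (ℕ.m⊔n≤o⇒n≤o _ _ αβ≤) s) c
  ... | inj₁ der = inj₁ (L∧ der)
  ... | inj₂ (refutation t (x ∷ y ∷ γ) p b δ w) = inj₂ (refutation t ((x , y) ∷ γ) p b δ w)
  addL (α ∨′ β) αβ≤ s c
    with addL α (ℕ.m⊔n≤o⇒m≤o _ _ αβ≤) s c | addL β (ℕ.m⊔n≤o⇒n≤o _ _ αβ≤) s c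
  ... | inj₁ der | inj₁ der′ = inj₁ (L∨ der der′)
  ... | inj₂ (refutation t (x ∷ γ) p b δ w) | _ = inj₂ (refutation t (inj₁ x ∷ γ) p b δ w)
  ... | inj₁ _ | inj₂ (refutation t (x ∷ γ) p b δ w) = inj₂ (refutation t (inj₂ x ∷ γ) p b δ w)
  addL (α →′ β) αβ≤ s c
    with addR α (ℕ.m⊔n≤o⇒m≤o _ _ αβ≤) s c | addL β (ℕ.m⊔n≤o⇒n≤o _ _ αβ≤) s c
  ... | inj₁ der | inj₁ der′ = inj₁ (L→ der der′)
  ... | inj₂ (refutation t γ p b (x ∷ δ) w) | _ = inj₂ (refutation t ((⊥-elim ∘ x) ∷ γ) p b δ w)
  ... | inj₁ _ | inj₂ (refutation t (x ∷ γ) p b δ w) = inj₂ (refutation t ((λ _ → x) ∷ γ) p b δ w)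
  addL (¬′ α) α≤ s c with addR α α≤ s c
  ... | inj₁ der = inj₁ (L¬ der)
  ... | inj₂ (refutation t γ p b (x ∷ δ) w) = inj₂ (refutation t (x ∷ γ) p b δ w)
  addL {Γ = Γ} (D G α) α< s c with isKT? L
  -- `D G α` is stored as processed and only its copy `α` is taken apart, so `D-T` is used once per
  -- occurrence and the search cannot cycle.
  ... | yes eq with addBox α< c (addL α (ℕ.<⇒≤ α<) s)
  ...   | inj₁ der = inj₁ (D-T eq (perm (shift (D G α) (α ∷ Γ) _) ↭-refl der))
  ...   | inj₂ (refutation t (x ∷ γ) p b δ w , y) =
          inj₂ (refutation t (Boxed⇒⊩ α y (λ _ → x) ∷ γ) p b δ w)
  addL {Γ = Γ} (D G α) α< s c | no neq with addBox α< c s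
  ...   | inj₁ der = inj₁ (perm (shift (D G α) Γ _) ↭-refl der)
  ...   | inj₂ (refutation t γ p b δ w , y) =
          inj₂ (refutation t (Boxed⇒⊩ α y (λ eq → contradiction eq neq) ∷ γ) p b δ w)

  addR (var p) p≤ = addΩ (var p) p≤
  addR ⊥′ ⊥≤ = addΩ bot ⊥≤
  addR (α ∧′ β) αβ≤ s c
    with addR α (ℕ.m⊔n≤o⇒m≤o _ _ αβ≤) s c | addR β (ℕ.m⊔n≤o⇒n≤o _ _ αβ≤) s c
  ... | inj₁ der | inj₁ der′ = inj₁ (R∧ der der′)
  ... | inj₂ (refutation t γ p b (x ∷ δ) w) | _ = inj₂ (refutation t γ p b ((x ∘ proj₁) ∷ δ) w)
  ... | inj₁ _ | inj₂ (refutation t γ p b (x ∷ δ) w) = inj₂ (refutation t γ p b ((x ∘ proj₂) ∷ δ) w)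
  addR (α ∨′ β) αβ≤ s c
    with addR α (ℕ.m⊔n≤o⇒m≤o _ _ αβ≤) (addR β (ℕ.m⊔n≤o⇒n≤o _ _ αβ≤) s) c
  ... | inj₁ der = inj₁ (R∨ der)
  ... | inj₂ (refutation t γ p b (x ∷ y ∷ δ) w) = inj₂ (refutation t γ p b (Sum.[ x , y ] ∷ δ) w)
  addR (α →′ β) αβ≤ s c
    with addL α (ℕ.m⊔n≤o⇒m≤o _ _ αβ≤) (addR β (ℕ.m⊔n≤o⇒n≤o _ _ αβ≤) s) c
  ... | inj₁ der = inj₁ (R→ der)
  ... | inj₂ (refutation t (x ∷ γ) p b (y ∷ δ) w) = inj₂ (refutation t γ p b ((λ f → y (f x)) ∷ δ) w)
  addR (¬′ α) α≤ s c with addL α α≤ s c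
  ... | inj₁ der = inj₁ (R¬ der)
  ... | inj₂ (refutation t (x ∷ γ) p b δ w) = inj₂ (refutation t γ p b ((λ f → f x) ∷ δ) w)
  addR (D G α) α< = addΩ (box α tt) α<

  addAllL : ∀ {d Δ} Γ → All (λ α → depth α ≤ d) Γ → Solvable d [] Δ → Solvable d Γ Δ
  addAllL []      []         s = s
  addAllL (α ∷ Γ) (α≤ ∷ Γ≤) s = addL α α≤ (addAllL Γ Γ≤ s)

  addAllR : ∀ {d Γ} Δ → All (λ α → depth α ≤ d) Δ → Solvable d Γ [] → Solvable d Γ Δ
  addAllR []      []         s = s
  addAllR (α ∷ Δ) (α≤ ∷ Δ≤) s = addR α α≤ (addAllR Δ Δ≤ s)

  map-box-const : ∀ {G} Θ → All (λ k → proj₁ k ≡ G) Θ → map (D G) (map proj₂ Θ) ≡ map □ Θ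
  map-box-const []      []          = refl
  map-box-const (_ ∷ Θ) (refl ∷ eqs) = cong (_ ∷_) (map-box-const Θ eqs)

  -- Modal rules at a saturated sequent.

  module Saturated {d} (solve : ∀ Γ Δ → All (λ α → depth α < d) Γ → All (λ α → depth α < d) Δ → Decided Γ Δ)
                   (c : Done d) where

    -- The side condition of `D-K` leaves no choice: boxes with group inside `G` must enter the
    -- premise, all others must stay behind. Each box on the right thus calls for a single premise.
    inside outside : Grp → List (Grp × Formula)
    inside  G = filter (_⊆ᴳ? G) (B c)
    outside G = filter (∁? (_⊆ᴳ? G)) (B c)

    side : Grp → List Formula
    side G = map var (P c) ++ map □ (outside G)

    split : ∀ G → side G ++ map □ (inside G) ↭ ante c
    split G = ↭-trans (↭-reflexive (++-assoc (map var (P c)) _ _))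
      (++⁺ˡ (map var (P c))
        (↭-trans (↭-reflexive (sym (map-++ □ (outside G) (inside G))))
                 (map⁺ □ (filter-∁-↭ (_⊆ᴳ? G) (B c)))))

    -- The predicate `Q` is left open to cover the side conditions of both `D-K` and `D-D`.
    side-Side : ∀ {Q : Grp → Set} G → (∀ {H} → H ⊈ G → Q H) → All (Side Q) (side G)
    side-Side G f = All.++⁺ (All.map⁺ (All.universal var (P c)))
      (All.map⁺ (All.map (λ {k} H⊈ → box (proj₂ k) (f {proj₁ k} H⊈)) (All.all-filter (∁? (_⊆ᴳ? G)) (B c))))

    inside< : ∀ G → All (λ α → depth α < d) (map proj₂ (inside G))
    inside< G = All.map⁺ (All.filter⁺ (_⊆ᴳ? G) (B< c))

    -- This is the demand of `Boxed` on children, sorted by child instead of by box.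
    Good : Grp × Tree → Set
    Good (H , u) = All (λ k → proj₁ k ⊆ H → u ⊩ proj₂ k) (B c)

    inside-Good : ∀ G {u} → All (u ⊩_) (map proj₂ (inside G)) → Good (G , u)
    inside-Good G us = All.tabulate λ k∈ k⊆ →
      All.lookup us (∈-map⁺ proj₂ (∈-filter⁺ (_⊆ᴳ? G) k∈ k⊆))

    RefutedBy : Formula → Grp × Tree → Set
    RefutedBy (D G β) (H , u) = G ≡ H × u ⊮ β
    RefutedBy _       _       = ⊥

    RefutedHere : Formula → Set
    RefutedHere (var p) = p ∉ P c
    RefutedHere ⊥′      = ⊤
    RefutedHere _       = ⊥

    Derivable : Set
    Derivable = L ⊢ ante c ⇒ Ω c

    refute : ∀ {ω} → Literal ω → depth ω ≤ d → ω ∈ Ω c →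
             Derivable ⊎ ((∃ λ k → Good k × RefutedBy ω k) ⊎ RefutedHere ω)
    refute (var p) _ ω∈ with DecMembership._∈?_ _≟_ p (P c)
    ... | no p∉ = inj₂ (inj₂ p∉)
    ... | yes p∈ with _ , e ← ∈⇒↭ ω∈ | _ , e′ ← ∈⇒↭ (∈-++⁺ˡ {ys = map □ (B c)} (∈-map⁺ var p∈)) =
      inj₁ (perm e′ e (init p))
    refute bot _ _ = inj₂ (inj₂ tt)
    refute (box {G} β _) β< ω∈ with solve (map proj₂ (inside G)) [ β ] (inside< G) (β< ∷ [])
    ... | inj₂ (u , us , uβ ∷ []) = inj₂ (inj₁ ((G , u) , inside-Good G us , refl , uβ))
    ... | inj₁ der with _ , e ← ∈⇒↭ ω∈ =
      inj₁ (perm (split G) e (D-K (inside G) (All.all-filter (_⊆ᴳ? G) (B c)) (side-Side G id)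
        (All.tail (All-resp-↭ (↭-sym e) (lits c))) der))

    Unconstrained : Agt → Set
    Unconstrained a = All (λ k → proj₁ k ⊈ ⁅ a ⁆) (B c)

    -- If some box has its group inside `⁅ a ⁆`, the premise of `D-D` is nonempty and is either
    -- derived or refuted by a child for `a`. If none has, the root may loop for `a`, since no box
    -- constrains that loop.
    successor : L ≡ KD-D → ∀ a → Derivable ⊎ ((∃ λ k → Good k × ⁅ a ⁆ ≡ proj₁ k) ⊎ Unconstrained a)
    successor eq a with any? (_⊆ᴳ? ⁅ a ⁆) (B c)
    ... | no none = inj₂ (inj₂ (All.¬Any⇒All¬ _ none))
    ... | yes some with solve (map proj₂ (inside ⁅ a ⁆)) [] (inside< ⁅ a ⁆) []
    ...   | inj₂ (u , us , []) = inj₂ (inj₁ ((⁅ a ⁆ , u) , inside-Good ⁅ a ⁆ us , refl))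
    ...   | inj₁ der = inj₁ (perm (↭-trans (++⁺ˡ (side ⁅ a ⁆) (↭-reflexive boxes)) (split ⁅ a ⁆)) ↭-refl
              (D-D a eq Θ≢[] (side-Side ⁅ a ⁆ λ { H⊈ refl → H⊈ id }) (lits c) der))
      where
      -- A nonempty group inside `⁅ a ⁆` equals it, so the selected boxes have the form that `D-D`
      -- requires.
      boxes : map (D ⁅ a ⁆) (map proj₂ (inside ⁅ a ⁆)) ≡ map □ (inside ⁅ a ⁆)
      boxes = map-box-const (inside ⁅ a ⁆)
        (All.map (λ {k} → ⊆⁅⁆⇒≡ (proj₁ k)) (All.all-filter (_⊆ᴳ? ⁅ a ⁆) (B c)))
      Θ≢[] : map proj₂ (inside ⁅ a ⁆) ≢ []
      Θ≢[] eq′ with _ , k∈ , k⊆ ← find some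
        with () ← subst (_ ∈_) eq′ (∈-map⁺ proj₂ (∈-filter⁺ (_⊆ᴳ? ⁅ a ⁆) k∈ k⊆))

    agents : Logic → List Agt
    agents KD-D = allFin (suc m)
    agents _    = []

    agents-KD : ∀ L {a} → a ∈ agents L → L ≡ KD-D
    agents-KD KD-D _ = refl

    -- A KD loop along the group of a stored box belongs to an agent with that group inside its
    -- singleton and no child covering it. But each agent has received a child of its own or is
    -- unconstrained.
    no-loop : ∀ L′ {ks} → All (λ a → Any (λ k → ⁅ a ⁆ ≡ proj₁ k) ks ⊎ Unconstrained a) (agents L′) →
              ∀ {k} → k ∈ B c → L′ ≢ KT-D → ¬ Loop L′ (proj₁ k) (node (P c) ks)
    no-loop KT-D _  _  neq _ = neq refl
    no-loop KD-D as k∈ _ (a , k⊆a , dead) with All.lookup as (∈-allFin a)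
    ... | inj₁ kid  = dead (Any.map (λ { refl x∈ → x∈ }) kid)
    ... | inj₂ none = All.lookup none k∈ k⊆a

    refuted : ∀ {ks ω} → Literal ω → Any (RefutedBy ω) ks ⊎ RefutedHere ω → node (P c) ks ⊮ ω
    refuted (var p) (inj₁ kid) _ with () ← proj₂ (proj₂ (find kid))
    refuted (var p) (inj₂ p∉)  p∈ = p∉ p∈
    refuted bot     _          ()
    refuted (box β _) (inj₁ kid) x with (_ , u) , k∈ , refl , u⊮β ← find kid =
      u⊮β (x u (inj₁ (lose k∈ (id , refl))))

    saturated : Derivable ⊎ Refutation [] [] c
    saturated with unless (Ω c) (λ ω∈ → refute (All.lookup (lits c) ω∈) (All.lookup (Ω≤ c) ω∈) ω∈)
                 | unless (agents L) (λ {a} a∈ → successor (agents-KD L a∈) a)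
    ... | inj₁ der | _        = inj₁ der
    ... | inj₂ _   | inj₁ der = inj₁ der
    ... | inj₂ rs  | inj₂ ss with ks , ks-good , ωs ← collect rs | ls , ls-good , as ← collect ss =
      -- The children `ks` refute the boxes on the right and `ls` provide successors for single
      -- agents; both kinds must respect every box on the left. Exactly the variables `P c` are true
      -- at the root.
      inj₂ (refutation (node (P c) (ks ++ ls)) [] (All.tabulate id)
        (All.tabulate λ k∈ → All.map (λ good → All.lookup good k∈) (All.++⁺ ks-good ls-good)
                           , no-loop L (All.map (Sum.map₁ (Any.++⁺ʳ ks)) as) k∈)
        [] (All.zipWith (λ (lit , r) → refuted lit (Sum.map₁ Any.++⁺ˡ r)) (lits c , ωs)))

  -- Recursion on modal depth and completeness.

  solve : ∀ d Γ Δ → All (λ α → depth α < d) Γ → All (λ α → depth α < d) Δ → Decided Γ Δ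
  -- No depth lies below `0`, so the sequent is empty and any tree refutes it.
  solve zero    []      []      _        _        = inj₂ (node [] [] , [] , [])
  solve zero    (_ ∷ _) _       (() ∷ _) _
  solve zero    []      (_ ∷ _) _        (() ∷ _)
  solve (suc d) Γ       Δ       Γ<       Δ<
    -- Formulas have depth at most `d` here, hence the contents of boxes have depth below `d` and
    -- the premises of the modal rules fall to `solve d`.
    with addAllL Γ (All.map s≤s⁻¹ Γ<) (addAllR Δ (All.map s≤s⁻¹ Δ<) (Saturated.saturated (solve d)))
           (done {P = []} [] [] [])
  ... | inj₁ der = inj₁ (perm (↭-reflexive (++-identityʳ Γ)) (↭-reflexive (++-identityʳ Δ)) der)
  ... | inj₂ (refutation t γ _ _ δ _) = inj₂ (t , γ , δ)

  complete : ∀ Γ Δ → Valid (λ M → IsFinite M × 𝕄 L M) Γ Δ → L ⊢ Γ ⇒ Δ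
  complete Γ Δ valid with d , bs ← depth-bound (Γ ++ Δ)
    with solve d Γ Δ (All.++⁻ˡ Γ bs) (All.++⁻ʳ Γ bs)
  ... | inj₁ der           = der
  ... | inj₂ (t , ts , fs) = contradiction valid (refutable⇒¬Valid t ts fs)

theorem4p8 : (m : ℕ) (PropVar : Set) → PropVar ↣ ℕ →
    let open Epistemic m PropVar in
    (L : Logic) (Γ Δ : List Formula) →
    Valid (λ M → IsFinite M × 𝕄 L M) Γ Δ →
    L ⊢ Γ ⇒ Δ
-- Countability enters through the decidable equality that an injection into `ℕ` induces.
theorem4p8 m PropVar inj L = Completeness.complete m PropVar (via-injection inj ℕ._≟_) L
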